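{- Let $\Sigma$ be a signature and let $\mathcal{I}'=\sum_{i\in\Lambda}\mathcal{I}_i$ be the coproduct of a family $(\mathcal{I}_i)_{i\in\Lambda}$ of $\Sigma$-models. Then for all concept descriptions $C,D\in\mathcal{EC}(\Sigma)$: $$(\forall i\in\Lambda,\ \mathcal{I}_i\models C\sqsubseteq D)\iff\mathcal{I}'\models C\sqsubseteq D.$$
   Context: A signature $\Sigma=(N_C,N_R)$ consists of a set $N_C$ of concept names and a set $N_R$ of role names. The set $\mathcal{EC}(\Sigma)$ of concept descriptions (description logic $\mathcal{ALC}$) is inductively generated by: $\bot,\top$; every $c\in N_C$; $C\sqcup D$, $C\sqcap D$, $C^c$ for $C,D\in\mathcal{EC}(\Sigma)$; $\forall r.C$, $\exists r.C$ for $C\in\mathcal{EC}(\Sigma)$, $r\in N_R$. A $\Sigma$-model $\mathcal{I}$ consists of a non-empty set $\Delta^{\mathcal{I}}$ (the carrier), a subset $c^{\mathcal{I}}\subseteq\Delta^{\mathcal{I}}$ for each $c\in N_C$ and a binary relation $r^{\mathcal{I}}\subseteq\Delta^{\mathcal{I}}\times\Delta^{\mathcal{I}}$ for each $r\in N_R$. The evaluation $C^{\mathcal{I}}\subseteq\Delta^{\mathcal{I}}$ of a concept description is defined by: $\top^{\mathcal{I}}=\Delta^{\mathcal{I}}$, $\bot^{\mathcal{I}}=\emptyset$, concept names are evaluated as given, $\sqcup,\sqcap$ are union and intersection, $(C^c)^{\mathcal{I}}=\Delta^{\mathcal{I}}\setminus C^{\mathcal{I}}$, $(\forall r.C)^{\mathcal{I}}=\{x\mid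 \forall y,\ (x,y)\in r^{\mathcal{I}}\Rightarrow y\in C^{\mathcal{I}}\}$, $(\exists r.C)^{\mathcal{I}}=\{x\mid \exists y,\ (x,y)\in r^{\mathcal{I}}\text{ and } y\in C^{\mathcal{I}}\}$. $\mathcal{I}\models C\sqsubseteq D$ means $C^{\mathcal{I}}\subseteq D^{\mathcal{I}}$. The coproduct $\sum_{i\in\Lambda}\mathcal{I}_i$ of a family of $\Sigma$-models indexed by a (non-empty) set $\Lambda$ has carrier $\{(i,a)\mid i\in\Lambda,a\in\Delta^{\mathcal{I}_i}\}$, interprets $c\in N_C$ as $\{(i,a)\mid i\in\Lambda, a\in c^{\mathcal{I}_i}\}$ and $r\in N_R$ as $\{((i,a),(i,b))\mid i\in\Lambda, (a,b)\in r^{\mathcal{I}_i}\}$. -}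

module Defs where

open import Data.Product.Base using (Σ; ∃; _×_; _,_)
open import Level using (Level; suc) renaming (_⊔_ to _⊔ˡ_)
open import Relation.Binary.Core using (Rel)
open import Relation.Unary using (Pred; _∈_; _⊆_; _∪_; _∩_; ∁)
open import Relation.Unary.Polymorphic using (∅; U)

record Signature (n m : Level) : Set (suc (n ⊔ˡ m)) where
  field
    ConceptName : Set n
    RoleName    : Set m

open Signature public

infixl 6 _⊔_
infixl 7 _⊓_
infix  9 _ᶜ
infixr 8 ∀[_]_ ∃[_]_

data Concept {n m : Level} (S : Signature n m) : Set (n ⊔ˡ m) where
  ⊥ ⊤         : Concept S
  name        : ConceptName S → Concept S
  _⊔_ _⊓_     : Concept S → Concept S → Concept S
  _ᶜ          : Concept S → Concept S
  ∀[_]_ ∃[_]_ : RoleName S → Concept S → Concept S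

-- Carriers, subsets and relations share one universe level, so that the
-- quantifiers over the carrier in the evaluation of ∀[ r ] C and ∃[ r ] C
-- yield subsets of that same level.
record Model {n m : Level} (S : Signature n m) (ℓ : Level) :
             Set (n ⊔ˡ m ⊔ˡ suc ℓ) where
  field
    Δ        : Set ℓ
    nonEmpty : Δ
    conceptᴵ : ConceptName S → Pred Δ ℓ
    roleᴵ    : RoleName S → Rel Δ ℓ

open Model public

module _ {n m ℓ : Level} {S : Signature n m} where

  ⟦_⟧ : Concept S → (I : Model S ℓ) → Pred (Δ I) ℓ
  ⟦ ⊥ ⟧        I = ∅
  ⟦ ⊤ ⟧        I = U
  ⟦ name c ⟧   I = conceptᴵ I c
  ⟦ C ⊔ D ⟧    I = ⟦ C ⟧ I ∪ ⟦ D ⟧ I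
  ⟦ C ⊓ D ⟧    I = ⟦ C ⟧ I ∩ ⟦ D ⟧ I
  ⟦ C ᶜ ⟧      I = ∁ (⟦ C ⟧ I)
  ⟦ ∀[ r ] C ⟧ I = λ x → ∀ y → roleᴵ I r x y → y ∈ ⟦ C ⟧ I
  ⟦ ∃[ r ] C ⟧ I = λ x → ∃ λ y → roleᴵ I r x y × y ∈ ⟦ C ⟧ I

  infix 4 _⊨_⊑_

  _⊨_⊑_ : Model S ℓ → Concept S → Concept S → Set ℓ
  I ⊨ C ⊑ D = ⟦ C ⟧ I ⊆ ⟦ D ⟧ I

  module _ {Λ : Set ℓ} (I : Λ → Model S ℓ) where

    data CoproductRole (r : RoleName S) : Rel (Σ Λ λ i → Δ (I i)) ℓ where
      within : ∀ {i a b} → roleᴵ (I i) r a b → CoproductRole r (i , a) (i , b)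

    -- The point of Λ is used only to show that the carrier is non-empty.
    coproduct : Λ → Model S ℓ
    coproduct i₀ = record
      { Δ        = Σ Λ λ i → Δ (I i)
      ; nonEmpty = i₀ , nonEmpty (I i₀)
      ; conceptᴵ = λ { c (i , a) → a ∈ conceptᴵ (I i) c }
      ; roleᴵ    = CoproductRole
      }

{-# OPTIONS --safe #-}
-- Roles of the coproduct never leave a summand, so the evaluation of a
-- concept at (i , a) only depends on the summand I i.
module Submission where

open import Defs
open import Data.Product.Base using (_,_)
open import Data.Product.Function.NonDependent.Propositional using (_×-⇔_)
open import Data.Sum.Function.Propositional using (_⊎-⇔_)
open import Function.Base using (_∘_)
open import Function.Bundles using (_⇔_; mk⇔; module Equivalence)
open import Function.Construct.Identity using (⇔-id)
open import Level using (Level)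
open import Relation.Unary using (_∈_)

open Equivalence using (to; from)

-- By induction on concepts, `a` satisfies `C` in `I i` exactly when `(i , a)` does in the
-- coproduct. Every point of the coproduct lies in one summand, so an inclusion there is the same
-- inclusion in all summands at once.

module _ {n m ℓ : Level} {S : Signature n m}
         {Λ : Set ℓ} (i₀ : Λ) (I : Λ → Model S ℓ) where

  -- An equivalence is carried through the induction because `_ᶜ` swaps its two directions.
  ⟦⟧-coproduct : ∀ C {i} {a : Δ (I i)} →
                 a ∈ ⟦ C ⟧ (I i) ⇔ (i , a) ∈ ⟦ C ⟧ (coproduct I i₀)
  ⟦⟧-coproduct ⊥          = ⇔-id _
  ⟦⟧-coproduct ⊤          = ⇔-id _
  ⟦⟧-coproduct (name c)   = ⇔-id _
  ⟦⟧-coproduct (C ⊔ D)    = ⟦⟧-coproduct C ⊎-⇔ ⟦⟧-coproduct D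
  ⟦⟧-coproduct (C ⊓ D)    = ⟦⟧-coproduct C ×-⇔ ⟦⟧-coproduct D
  ⟦⟧-coproduct (C ᶜ)      = mk⇔ (_∘ from (⟦⟧-coproduct C)) (_∘ to (⟦⟧-coproduct C))
  ⟦⟧-coproduct (∀[ r ] C) = mk⇔
    -- Matching `within` forces the successor into summand `i`, where `h` applies.
    (λ { h _ (within p) → to (⟦⟧-coproduct C) (h _ p) })
    (λ h _ p → from (⟦⟧-coproduct C) (h _ (within p)))
  ⟦⟧-coproduct (∃[ r ] C) = mk⇔
    (λ (_ , p , q) → _ , within p , to (⟦⟧-coproduct C) q)
    (λ { (_ , within p , q) → _ , p , from (⟦⟧-coproduct C) q })

corollary2 : ∀ {n m ℓ : Level} (S : Signature n m)
    {Λ : Set ℓ} (i₀ : Λ) (I : Λ → Model S ℓ) (C D : Concept S) →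
    (∀ (i : Λ) → I i ⊨ C ⊑ D) ⇔ (coproduct I i₀ ⊨ C ⊑ D)
corollary2 S i₀ I C D = mk⇔
  (λ h {(i , _)} → to (⟦⟧-coproduct i₀ I D) ∘ h i ∘ from (⟦⟧-coproduct i₀ I C))
  (λ h i {a} → from (⟦⟧-coproduct i₀ I D) ∘ h ∘ to (⟦⟧-coproduct i₀ I C {a = a}))
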